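{- Let $P$ be a program and $x$ an input. For $n\in\mathbb{N}$ put $a_n = n!$ if $P(x)$ has halted by step $n$, and $a_n = 0$ if $P(x)$ has not halted by step $n$. Let $S(z)=\sum_{n=0}^{\infty} a_n z^n$, where $z$ is a complex variable. Then: (1) If $P$ does not halt on input $x$, then $S(z)=0$ for all $z\in\mathbb{C}$ (in particular the series converges everywhere). (2) If $P$ halts on input $x$, then $S(z)$ converges only at $z=0$ and diverges for all $z\in\mathbb{C}$ with $z\neq 0$.
   Context: Programs are Turing machines (encoded by natural numbers). "$P(x)$ has halted by step $n$" means that the computation of $P$ on input $x$ reaches a halting state within at most $n$ steps; once $P(x)$ has halted by step $n_0$ it has halted by step $n$ for all $n\ge n_0$. $P(x)$ halts if and only if it has halted by step $n$ for some $n\in\mathbb{N}$. A power series $\sum_{n\ge 0} a_n z^n$ converges at $z_0$ if its partial sums $\sum_{n=0}^{N} a_n z_0^n$ converge in $\mathbb{C}$ as $N\to\infty$, and diverges at $z_0$ otherwise. Here $\mathbb{N}=\{0,1,2,\dots\}$. -}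

module Defs where

open import Data.Bool.Base using (if_then_else_; _∧_)
open import Data.List.Base using (List; []; _∷_)
open import Data.Nat.Base using (ℕ; zero; suc; _≤_; _⊔_; _!)
import Data.Nat.Base as ℕ
open import Data.Nat.Binary.Base using (ℕᵇ; zero; 2[1+_]; 1+[2_]; toℕ; fromℕ)
open import Data.Nat.Binary.Properties using (fromℕ-toℕ)
import Data.Nat.Properties as ℕ
open import Data.Integer.Base using (+_)
open import Data.Product.Base using (∃; _×_; _,_; map₂; map₁)
open import Data.Rational.Base as ℚ using (ℚ; 0ℚ; 1ℚ; ½; Positive; positive)
import Data.Rational.Properties as ℚ
open import Data.Rational.Solver using (module +-*-Solver)
open import Relation.Binary.PropositionalEquality
  using (_≡_; refl; sym; trans; cong; cong₂; subst)
open import Relation.Nullary.Decidable using (Dec; does; map′)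
open import Relation.Nullary.Negation using (¬_)

------------------------------------------------------------------------
-- Turing machines

State Symbol : Set
State  = ℕ
Symbol = ℕ

haltState : State
haltState = 0

blank : Symbol
blank = 0

data Move : Set where
  left right : Move

Action : Set
Action = State × Symbol × Move

-- In state `state` reading `symbol`, perform `action`.
record Instruction : Set where
  constructor ⟨_,_,_⟩
  field
    state  : State
    symbol : Symbol
    action : Action

-- Only finitely many states and symbols occur in `table`.
record Machine : Set where
  constructor machine
  field
    start : State
    table : List Instruction

-- The first matching instruction is the one that counts, so every machine
-- is deterministic.  If none matches, the machine enters the halting state.
lookupAction : List Instruction → State → Symbol → Action
lookupAction []                       q s = haltState , s , right
lookupAction (⟨ q′ , s′ , act ⟩ ∷ is) q s =
  if does (q ℕ.≟ q′) ∧ does (s ℕ.≟ s′) then act else lookupAction is q s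

-- The tape is two-way infinite and blank outside the cells listed.  Both
-- `lefts` and `rights` start with the cell adjacent to the head.
record Config : Set where
  constructor config
  field
    state  : State
    lefts  : List Symbol
    head   : Symbol
    rights : List Symbol

Halted : Config → Set
Halted c = Config.state c ≡ haltState

perform : Action → Config → Config
perform (q , s , left)  (config _ []       _ rs)       = config q [] blank (s ∷ rs)
perform (q , s , left)  (config _ (l ∷ ls) _ rs)       = config q ls l (s ∷ rs)
perform (q , s , right) (config _ ls       _ [])       = config q (s ∷ ls) blank []
perform (q , s , right) (config _ ls       _ (r ∷ rs)) = config q (s ∷ ls) r rs

step : Machine → Config → Config
step M c@(config q _ s _) =
  if does (q ℕ.≟ haltState) then c else perform (lookupAction (Machine.table M) q s) c

Input : Set
Input = List Symbol

initial : Machine → Input → Config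
initial M []      = config (Machine.start M) [] blank []
initial M (s ∷ x) = config (Machine.start M) [] s x

run : Machine → Input → ℕ → Config
run M x zero    = initial M x
run M x (suc n) = step M (run M x n)

------------------------------------------------------------------------
-- Programs: Turing machines encoded by natural numbers

Program : Set
Program = ℕ

-- ℕᵇ is bijective binary notation, i.e. words over the two digits 2[1+_]
-- and 1+[2_].  A list of numbers is written as a word in which k is a block
-- of k digits 2[1+_] terminated by a digit 1+[2_].
decodeBlocks : ℕ → ℕᵇ → List ℕ
decodeBlocks k zero     = []
decodeBlocks k 2[1+ w ] = decodeBlocks (suc k) w
decodeBlocks k 1+[2 w ] = k ∷ decodeBlocks 0 w

decodeMove : ℕ → Move
decodeMove zero    = left
decodeMove (suc _) = right

-- Fewer than five remaining numbers are ignored.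
decodeTable : List ℕ → List Instruction
decodeTable (q ∷ s ∷ q′ ∷ s′ ∷ m ∷ ks) =
  ⟨ q , s , (q′ , s′ , decodeMove m) ⟩ ∷ decodeTable ks
decodeTable _ = []

decodeMachine : List ℕ → Machine
decodeMachine []       = machine haltState []
decodeMachine (q ∷ ks) = machine q (decodeTable ks)

decode : Program → Machine
decode P = decodeMachine (decodeBlocks 0 (fromℕ P))

encodeBlock : ℕ → ℕᵇ → ℕᵇ
encodeBlock zero    w = 1+[2 w ]
encodeBlock (suc k) w = 2[1+ encodeBlock k w ]

encodeBlocks : List ℕ → ℕᵇ
encodeBlocks []       = zero
encodeBlocks (k ∷ ks) = encodeBlock k (encodeBlocks ks)

decode-encodeBlock : ∀ j k w →
  decodeBlocks j (encodeBlock k w) ≡ (j ℕ.+ k) ∷ decodeBlocks 0 w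
decode-encodeBlock j zero    w = cong (_∷ decodeBlocks 0 w) (sym (ℕ.+-identityʳ j))
decode-encodeBlock j (suc k) w =
  trans (decode-encodeBlock (suc j) k w) (cong (_∷ decodeBlocks 0 w) (sym (ℕ.+-suc j k)))

decode-encodeBlocks : ∀ ks → decodeBlocks 0 (encodeBlocks ks) ≡ ks
decode-encodeBlocks []       = refl
decode-encodeBlocks (k ∷ ks) =
  trans (decode-encodeBlock 0 k _) (cong (k ∷_) (decode-encodeBlocks ks))

encodeMove : Move → ℕ
encodeMove left  = 0
encodeMove right = 1

decode-encodeMove : ∀ m → decodeMove (encodeMove m) ≡ m
decode-encodeMove left  = refl
decode-encodeMove right = refl

encodeTable : List Instruction → List ℕ
encodeTable [] = []
encodeTable (⟨ q , s , (q′ , s′ , m) ⟩ ∷ is) =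
  q ∷ s ∷ q′ ∷ s′ ∷ encodeMove m ∷ encodeTable is

decode-encodeTable : ∀ is → decodeTable (encodeTable is) ≡ is
decode-encodeTable [] = refl
decode-encodeTable (⟨ q , s , (q′ , s′ , m) ⟩ ∷ is) =
  cong₂ (λ m′ is′ → ⟨ q , s , (q′ , s′ , m′) ⟩ ∷ is′)
    (decode-encodeMove m) (decode-encodeTable is)

encode : Machine → Program
encode (machine q is) = toℕ (encodeBlocks (q ∷ encodeTable is))

-- Quantifying over all programs is quantifying over all machines.
decode-encode : ∀ M → decode (encode M) ≡ M
decode-encode (machine q is) =
  trans (cong (λ w → decodeMachine (decodeBlocks 0 w))
              (fromℕ-toℕ (encodeBlocks (q ∷ encodeTable is))))
  (trans (cong decodeMachine (decode-encodeBlocks (q ∷ encodeTable is)))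
         (cong (machine q) (decode-encodeTable is)))

HaltedBy : Program → Input → ℕ → Set
HaltedBy P x n = ∃ λ m → m ≤ n × Halted (run (decode P) x m)

haltedBy? : ∀ P x n → Dec (HaltedBy P x n)
haltedBy? P x n =
  map′ (map₂ (map₁ ℕ.≤-pred)) (map₂ (map₁ ℕ.s≤s))
    (ℕ.anyUpTo? (λ m → Config.state (run (decode P) x m) ℕ.≟ haltState) (suc n))

Halts : Program → Input → Set
Halts P x = ∃ λ n → HaltedBy P x n

------------------------------------------------------------------------
-- Real numbers, as Cauchy sequences of rationals

IsCauchy : (ℕ → ℚ) → Set
IsCauchy u = ∀ ε → 0ℚ ℚ.< ε →
  ∃ λ N → ∀ m n → N ≤ m → N ≤ n → ℚ.∣ u m ℚ.- u n ∣ ℚ.< ε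

private

  half-pos : ∀ {ε} → 0ℚ ℚ.< ε → 0ℚ ℚ.< ε ℚ.* ½
  half-pos {ε} ε>0 = ℚ.positive⁻¹ _ ⦃ ℚ.pos*pos⇒pos ε ⦃ positive ε>0 ⦄ ½ ⦄

  half+half : ∀ ε → ε ℚ.* ½ ℚ.+ ε ℚ.* ½ ≡ ε
  half+half ε = trans (sym (ℚ.*-distribˡ-+ ε ½ ½)) (ℚ.*-identityʳ ε)

  -- ε / b for b > 0
  quot : ∀ ε b → 0ℚ ℚ.< ε → 0ℚ ℚ.< b → ∃ λ δ → 0ℚ ℚ.< δ × b ℚ.* δ ≡ ε
  quot ε b ε>0 b>0 = ε ℚ.* b⁻¹
    , ℚ.positive⁻¹ _ ⦃ ℚ.pos*pos⇒pos ε b⁻¹ ⦃ ℚ.1/pos⇒pos b ⦄ ⦄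
    , trans (ℚ.*-comm b (ε ℚ.* b⁻¹)) (trans (ℚ.*-assoc ε b⁻¹ b)
        (trans (cong (ε ℚ.*_) (ℚ.*-inverseˡ b)) (ℚ.*-identityʳ ε)))
    where
    instance _ = positive b>0
             _ = positive ε>0
             _ = ℚ.pos⇒nonZero b
    b⁻¹ = ℚ.1/ b

  bounded : ∀ u → IsCauchy u →
    ∃ λ b → 0ℚ ℚ.< b × ∃ λ N → ∀ n → N ≤ n → ℚ.∣ u n ∣ ℚ.≤ b
  bounded u cau with N , close ← cau 1ℚ (ℚ.positive⁻¹ 1ℚ) =
    1ℚ ℚ.+ ℚ.∣ u N ∣
    , ℚ.+-mono-<-≤ (ℚ.positive⁻¹ 1ℚ) (ℚ.0≤∣p∣ (u N))
    , N
    , λ n N≤n → begin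
        ℚ.∣ u n ∣                         ≡⟨ cong ℚ.∣_∣ (solve 2 (λ a b → a := (a :- b) :+ b) refl (u n) (u N)) ⟩
        ℚ.∣ (u n ℚ.- u N) ℚ.+ u N ∣       ≤⟨ ℚ.∣p+q∣≤∣p∣+∣q∣ (u n ℚ.- u N) (u N) ⟩
        ℚ.∣ u n ℚ.- u N ∣ ℚ.+ ℚ.∣ u N ∣   ≤⟨ ℚ.+-monoˡ-≤ ℚ.∣ u N ∣ (ℚ.<⇒≤ (close n N N≤n ℕ.≤-refl)) ⟩
        1ℚ ℚ.+ ℚ.∣ u N ∣                  ∎
    where open ℚ.≤-Reasoning
          open +-*-Solver

abstract

  const-cauchy : ∀ q → IsCauchy (λ _ → q)
  const-cauchy q ε ε>0 =
    0 , λ _ _ _ _ → subst (ℚ._< ε) (sym (cong ℚ.∣_∣ (ℚ.+-inverseʳ q))) ε>0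

  neg-cauchy : ∀ u → IsCauchy u → IsCauchy (λ n → ℚ.- u n)
  neg-cauchy u cu ε ε>0 with N , close ← cu ε ε>0 =
    N , λ m n N≤m N≤n →
      subst (ℚ._< ε)
        (trans (sym (ℚ.∣-p∣≡∣p∣ (u m ℚ.- u n)))
               (cong ℚ.∣_∣ (solve 2 (λ a b → :- (a :- b) := :- a :- :- b) refl (u m) (u n))))
        (close m n N≤m N≤n)
    where open +-*-Solver

  +-cauchy : ∀ u v → IsCauchy u → IsCauchy v → IsCauchy (λ n → u n ℚ.+ v n)
  +-cauchy u v cu cv ε ε>0
    with M , closeᵘ ← cu (ε ℚ.* ½) (half-pos ε>0)
       | N , closeᵛ ← cv (ε ℚ.* ½) (half-pos ε>0) =
    M ⊔ N , λ m n ≤m ≤n → begin-strict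
      ℚ.∣ (u m ℚ.+ v m) ℚ.- (u n ℚ.+ v n) ∣
        ≡⟨ cong ℚ.∣_∣ (solve 4 (λ a b c d → (a :+ b) :- (c :+ d) := (a :- c) :+ (b :- d)) refl (u m) (v m) (u n) (v n)) ⟩
      ℚ.∣ (u m ℚ.- u n) ℚ.+ (v m ℚ.- v n) ∣
        ≤⟨ ℚ.∣p+q∣≤∣p∣+∣q∣ (u m ℚ.- u n) (v m ℚ.- v n) ⟩
      ℚ.∣ u m ℚ.- u n ∣ ℚ.+ ℚ.∣ v m ℚ.- v n ∣
        <⟨ ℚ.+-mono-< (closeᵘ m n (ℕ.m⊔n≤o⇒m≤o M N ≤m) (ℕ.m⊔n≤o⇒m≤o M N ≤n))
                      (closeᵛ m n (ℕ.m⊔n≤o⇒n≤o M N ≤m) (ℕ.m⊔n≤o⇒n≤o M N ≤n)) ⟩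
      ε ℚ.* ½ ℚ.+ ε ℚ.* ½
        ≡⟨ half+half ε ⟩
      ε ∎
    where open ℚ.≤-Reasoning
          open +-*-Solver

private

  difference-of-products : ∀ p q r s →
    p ℚ.* q ℚ.- r ℚ.* s ≡ p ℚ.* (q ℚ.- s) ℚ.+ s ℚ.* (p ℚ.- r)
  difference-of-products =
    solve 4 (λ p q r s → p :* q :- r :* s := p :* (q :- s) :+ s :* (p :- r)) refl
    where open +-*-Solver

  scaled : ∀ p q {b δ} → 0ℚ ℚ.< b → ℚ.∣ p ∣ ℚ.≤ b → ℚ.∣ q ∣ ℚ.< δ →
           ℚ.∣ p ℚ.* q ∣ ℚ.< b ℚ.* δ
  scaled p q {b} {δ} b>0 p≤b q<δ = begin-strict
    ℚ.∣ p ℚ.* q ∣       ≡⟨ ℚ.∣p*q∣≡∣p∣*∣q∣ p q ⟩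
    ℚ.∣ p ∣ ℚ.* ℚ.∣ q ∣  ≤⟨ ℚ.*-monoʳ-≤-nonNeg ℚ.∣ q ∣ ⦃ ℚ.nonNegative (ℚ.0≤∣p∣ q) ⦄ p≤b ⟩
    b ℚ.* ℚ.∣ q ∣        <⟨ ℚ.*-monoʳ-<-pos b ⦃ positive b>0 ⦄ q<δ ⟩
    b ℚ.* δ             ∎
    where open ℚ.≤-Reasoning

  product-close : ∀ p q r s {b c δ η ε} →
    0ℚ ℚ.< b → ℚ.∣ p ∣ ℚ.≤ b → ℚ.∣ q ℚ.- s ∣ ℚ.< δ → b ℚ.* δ ≡ ε ℚ.* ½ →
    0ℚ ℚ.< c → ℚ.∣ s ∣ ℚ.≤ c → ℚ.∣ p ℚ.- r ∣ ℚ.< η → c ℚ.* η ≡ ε ℚ.* ½ →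
    ℚ.∣ p ℚ.* q ℚ.- r ℚ.* s ∣ ℚ.< ε
  product-close p q r s {b} {c} {δ} {η} {ε} b>0 p≤b q-s<δ bδ c>0 s≤c p-r<η cη =
    begin-strict
    ℚ.∣ p ℚ.* q ℚ.- r ℚ.* s ∣
      ≡⟨ cong ℚ.∣_∣ (difference-of-products p q r s) ⟩
    ℚ.∣ p ℚ.* (q ℚ.- s) ℚ.+ s ℚ.* (p ℚ.- r) ∣
      ≤⟨ ℚ.∣p+q∣≤∣p∣+∣q∣ (p ℚ.* (q ℚ.- s)) (s ℚ.* (p ℚ.- r)) ⟩
    ℚ.∣ p ℚ.* (q ℚ.- s) ∣ ℚ.+ ℚ.∣ s ℚ.* (p ℚ.- r) ∣
      <⟨ ℚ.+-mono-< (scaled p (q ℚ.- s) b>0 p≤b q-s<δ)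
                    (scaled s (p ℚ.- r) c>0 s≤c p-r<η) ⟩
    b ℚ.* δ ℚ.+ c ℚ.* η
      ≡⟨ cong₂ ℚ._+_ bδ cη ⟩
    ε ℚ.* ½ ℚ.+ ε ℚ.* ½
      ≡⟨ half+half ε ⟩
    ε ∎
    where open ℚ.≤-Reasoning

abstract

  *-cauchy : ∀ u v → IsCauchy u → IsCauchy v → IsCauchy (λ n → u n ℚ.* v n)
  *-cauchy u v cu cv ε ε>0 =
    let b , b>0 , B , u≤b = bounded u cu
        c , c>0 , C , v≤c = bounded v cv
        δ , δ>0 , bδ      = quot (ε ℚ.* ½) b (half-pos ε>0) b>0
        η , η>0 , cη      = quot (ε ℚ.* ½) c (half-pos ε>0) c>0
        N , closeᵛ        = cv δ δ>0
        M , closeᵘ        = cu η η>0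
    in (B ⊔ C) ⊔ (M ⊔ N) , λ m n ≤m ≤n →
      let BC≤m = ℕ.m⊔n≤o⇒m≤o (B ⊔ C) (M ⊔ N) ≤m
          MN≤m = ℕ.m⊔n≤o⇒n≤o (B ⊔ C) (M ⊔ N) ≤m
          BC≤n = ℕ.m⊔n≤o⇒m≤o (B ⊔ C) (M ⊔ N) ≤n
          MN≤n = ℕ.m⊔n≤o⇒n≤o (B ⊔ C) (M ⊔ N) ≤n
      in product-close (u m) (v m) (u n) (v n)
           b>0 (u≤b m (ℕ.m⊔n≤o⇒m≤o B C BC≤m))
           (closeᵛ m n (ℕ.m⊔n≤o⇒n≤o M N MN≤m) (ℕ.m⊔n≤o⇒n≤o M N MN≤n)) bδ
           c>0 (v≤c n (ℕ.m⊔n≤o⇒n≤o B C BC≤n))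
           (closeᵘ m n (ℕ.m⊔n≤o⇒m≤o M N MN≤m) (ℕ.m⊔n≤o⇒m≤o M N MN≤n)) cη

record ℝ : Set where
  constructor real
  field
    seq    : ℕ → ℚ
    cauchy : IsCauchy seq

open ℝ using (seq)

infix  4 _≈ℝ_ _<ℝ_
infixl 6 _+ℝ_ _-ℝ_
infixl 7 _*ℝ_
infix  8 -ℝ_

_≈ℝ_ : ℝ → ℝ → Set
x ≈ℝ y = ∀ ε → 0ℚ ℚ.< ε →
  ∃ λ N → ∀ n → N ≤ n → ℚ.∣ seq x n ℚ.- seq y n ∣ ℚ.< ε

_<ℝ_ : ℝ → ℝ → Set
x <ℝ y = ∃ λ ε → 0ℚ ℚ.< ε ×
  (∃ λ N → ∀ n → N ≤ n → seq x n ℚ.+ ε ℚ.≤ seq y n)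

fromℚ : ℚ → ℝ
fromℚ q = real (λ _ → q) (const-cauchy q)

0ℝ : ℝ
0ℝ = fromℚ 0ℚ

-ℝ_ : ℝ → ℝ
-ℝ real u cu = real (λ n → ℚ.- u n) (neg-cauchy u cu)

_+ℝ_ _-ℝ_ _*ℝ_ : ℝ → ℝ → ℝ
real u cu +ℝ real v cv = real (λ n → u n ℚ.+ v n) (+-cauchy u v cu cv)
x -ℝ y = x +ℝ (-ℝ y)
real u cu *ℝ real v cv = real (λ n → u n ℚ.* v n) (*-cauchy u v cu cv)

------------------------------------------------------------------------
-- Complex numbers

infixl 6 _+ᶜ_ _-ᶜ_
infixl 7 _*ᶜ_
infixr 8 _^ᶜ_
infix  4 _≈ᶜ_
infix  5 _+i_

record ℂ : Set where
  constructor _+i_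
  field
    re im : ℝ

open ℂ using (re; im)

_≈ᶜ_ : ℂ → ℂ → Set
z ≈ᶜ w = re z ≈ℝ re w × im z ≈ℝ im w

fromℕᶜ : ℕ → ℂ
fromℕᶜ n = fromℚ (+ n ℚ./ 1) +i 0ℝ

0ᶜ 1ᶜ : ℂ
0ᶜ = fromℕᶜ 0
1ᶜ = fromℕᶜ 1

_+ᶜ_ _-ᶜ_ _*ᶜ_ : ℂ → ℂ → ℂ
z +ᶜ w = (re z +ℝ re w) +i (im z +ℝ im w)
z -ᶜ w = (re z -ℝ re w) +i (im z -ℝ im w)
z *ᶜ w = (re z *ℝ re w -ℝ im z *ℝ im w) +i (re z *ℝ im w +ℝ im z *ℝ re w)

_^ᶜ_ : ℂ → ℕ → ℂ
z ^ᶜ zero  = 1ᶜ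
z ^ᶜ suc n = z *ᶜ z ^ᶜ n

∣_∣² : ℂ → ℝ
∣ z ∣² = re z *ℝ re z +ℝ im z *ℝ im z

-- For ε > 0 the condition ∣ u n - l ∣ < ε is written without square roots.
_⟶_ : (ℕ → ℂ) → ℂ → Set
u ⟶ l = ∀ ε → 0ℝ <ℝ ε → ∃ λ N → ∀ n → N ≤ n → ∣ u n -ᶜ l ∣² <ℝ ε *ℝ ε

------------------------------------------------------------------------
-- Power series

-- ∑_{n=0}^{N} a n · zⁿ, with both ends included
partialSum : (ℕ → ℂ) → ℂ → ℕ → ℂ
partialSum a z zero    = a 0 *ᶜ z ^ᶜ 0
partialSum a z (suc N) = partialSum a z N +ᶜ a (suc N) *ᶜ z ^ᶜ suc N

SumsTo : (ℕ → ℂ) → ℂ → ℂ → Set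
SumsTo a z s = partialSum a z ⟶ s

ConvergesAt : (ℕ → ℂ) → ℂ → Set
ConvergesAt a z = ∃ λ s → SumsTo a z s

DivergesAt : (ℕ → ℂ) → ℂ → Set
DivergesAt a z = ¬ ConvergesAt a z

coeff : Program → Input → ℕ → ℂ
coeff P x n = if does (haltedBy? P x n) then fromℕᶜ (n !) else 0ᶜ

{-# OPTIONS --safe #-}

-- If the series converges at z, its terms are eventually bounded.  Once P(x)
-- has halted the terms are n! zⁿ, and n! εⁿ is unbounded for every rational
-- ε > 0, so the bound forces ∣ z ∣² < ε.  This proves z ≈ 0 directly, without
-- deciding whether z is zero.  All estimates are made on the rational
-- approximations, where ∣ z w ∣² = ∣ z ∣² ∣ w ∣² holds exactly.

module Submission where

open import Defs
open import Algebra.Bundles using (CommutativeRing)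
open import Data.Integer.Base as ℤ using (+_)
import Data.Integer.Properties as ℤ
open import Data.Nat.Coprimality using (Coprime)
open import Data.Nat.Base using (ℕ; zero; suc; _≤_; _⊔_; _!; z≤n; s≤s)
import Data.Nat.Base as ℕ
import Data.Nat.Properties as ℕ
open import Data.Product.Base using (∃; _×_; _,_)
open import Data.Rational.Base as ℚ using (ℚ; mkℚ; 0ℚ; 1ℚ; ½; positive; nonNegative)
import Data.Rational.Properties as ℚ
open import Data.Rational.Solver using (module +-*-Solver)
open import Data.Rational.Unnormalised.Base as ℚᵘ using (mkℚᵘ; *≡*; *≤*)
import Data.Rational.Unnormalised.Properties as ℚᵘ
open import Data.Sum.Base using (inj₁; inj₂)
open import Function.Base using (_∘_)
open import Function.Bundles using (_⇔_; mk⇔)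
open import Relation.Binary.PropositionalEquality
  using (_≡_; refl; sym; trans; cong; cong₂; subst)
open import Relation.Nullary.Decidable using (dec-true; dec-false)
open import Relation.Nullary.Negation using (¬_)

open import Algebra.Properties.CommutativeSemiring.Exp
  (CommutativeRing.commutativeSemiring ℚ.+-*-commutativeRing)
  using (_^_; ^-homo-*; ^-distrib-*)

open ℝ using (seq)
open ℂ using (re; im)

-- Squares and powers of rationals

square-abs : ∀ p → p ℚ.* p ≡ ℚ.∣ p ∣ ℚ.* ℚ.∣ p ∣
square-abs p with ℚ.∣p∣≡p∨∣p∣≡-p p
... | inj₁ eq = sym (cong₂ ℚ._*_ eq eq)
... | inj₂ eq = trans (solve 1 (λ a → a :* a := :- a :* :- a) refl p) (sym (cong₂ ℚ._*_ eq eq))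
  where open +-*-Solver

0≤p*q : ∀ {p q} → 0ℚ ℚ.≤ p → 0ℚ ℚ.≤ q → 0ℚ ℚ.≤ p ℚ.* q
0≤p*q {p} {q} p≥0 q≥0 =
  ℚ.nonNegative⁻¹ _ ⦃ ℚ.nonNeg*nonNeg⇒nonNeg p ⦃ nonNegative p≥0 ⦄ q ⦃ nonNegative q≥0 ⦄ ⦄

0<p*q : ∀ {p q} → 0ℚ ℚ.< p → 0ℚ ℚ.< q → 0ℚ ℚ.< p ℚ.* q
0<p*q {p} {q} p>0 q>0 =
  ℚ.positive⁻¹ _ ⦃ ℚ.pos*pos⇒pos p ⦃ positive p>0 ⦄ q ⦃ positive q>0 ⦄ ⦄

0≤p² : ∀ p → 0ℚ ℚ.≤ p ℚ.* p
0≤p² p = subst (0ℚ ℚ.≤_) (sym (square-abs p)) (0≤p*q (ℚ.0≤∣p∣ p) (ℚ.0≤∣p∣ p))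

-- The chain passes through `p * s`, so the sign conditions fall on `p` and `s`.
*-mono-≤ : ∀ {p q r s} → 0ℚ ℚ.≤ p → 0ℚ ℚ.≤ s → p ℚ.≤ q → r ℚ.≤ s → p ℚ.* r ℚ.≤ q ℚ.* s
*-mono-≤ {p} {q} {r} {s} p≥0 s≥0 p≤q r≤s = ℚ.≤-trans
  (ℚ.*-monoˡ-≤-nonNeg p ⦃ nonNegative p≥0 ⦄ r≤s)
  (ℚ.*-monoʳ-≤-nonNeg s ⦃ nonNegative s≥0 ⦄ p≤q)

∣p∣≤q⇒p²≤q² : ∀ p {q} → ℚ.∣ p ∣ ℚ.≤ q → p ℚ.* p ℚ.≤ q ℚ.* q
∣p∣≤q⇒p²≤q² p {q} p≤q = subst (ℚ._≤ q ℚ.* q) (sym (square-abs p))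
  (*-mono-≤ (ℚ.0≤∣p∣ p) (ℚ.≤-trans (ℚ.0≤∣p∣ p) p≤q) p≤q p≤q)

p²<q²⇒∣p∣<q : ∀ p {q} → 0ℚ ℚ.≤ q → p ℚ.* p ℚ.< q ℚ.* q → ℚ.∣ p ∣ ℚ.< q
p²<q²⇒∣p∣<q p {q} q≥0 p²<q² = ℚ.≰⇒> λ q≤p → ℚ.<-irrefl refl (ℚ.<-≤-trans p²<q²
  (subst (q ℚ.* q ℚ.≤_) (sym (square-abs p)) (*-mono-≤ q≥0 (ℚ.0≤∣p∣ p) q≤p q≤p)))

^-nonNeg : ∀ {p} n → 0ℚ ℚ.≤ p → 0ℚ ℚ.≤ p ^ n
^-nonNeg zero    p≥0 = ℚ.nonNegative⁻¹ 1ℚ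
^-nonNeg (suc n) p≥0 = 0≤p*q p≥0 (^-nonNeg n p≥0)

^-mono-≤ : ∀ {p q} n → 0ℚ ℚ.≤ p → p ℚ.≤ q → p ^ n ℚ.≤ q ^ n
^-mono-≤ zero    p≥0 p≤q = ℚ.≤-refl
^-mono-≤ (suc n) p≥0 p≤q =
  *-mono-≤ p≥0 (^-nonNeg n (ℚ.≤-trans p≥0 p≤q)) p≤q (^-mono-≤ n p≥0 p≤q)

1≤p⇒1≤p^n : ∀ {p} n → 1ℚ ℚ.≤ p → 1ℚ ℚ.≤ p ^ n
1≤p⇒1≤p^n zero    1≤p = ℚ.≤-refl
1≤p⇒1≤p^n {p} (suc n) 1≤p = *-mono-≤ (ℚ.nonNegative⁻¹ 1ℚ)
  (^-nonNeg n (ℚ.≤-trans (ℚ.nonNegative⁻¹ 1ℚ) 1≤p)) 1≤p (1≤p⇒1≤p^n n 1≤p)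

1≤p⇒p≤p^[1+n] : ∀ {p} n → 1ℚ ℚ.≤ p → p ℚ.≤ p ^ suc n
1≤p⇒p≤p^[1+n] {p} n 1≤p = subst (ℚ._≤ p ^ suc n) (ℚ.*-identityʳ p)
  (ℚ.*-monoˡ-≤-nonNeg p ⦃ nonNegative (ℚ.≤-trans (ℚ.nonNegative⁻¹ 1ℚ) 1≤p) ⦄ (1≤p⇒1≤p^n n 1≤p))

-- Natural numbers as rationals

-- This is the expression used in `fromℕᶜ`, so the real part of `fromℕᶜ n` is `ι n` by computation.
ι : ℕ → ℚ
ι n = + n ℚ./ 1

-- The fraction `+ n / 1` is normalised by a gcd and is stuck for a variable `n`; arithmetic on `ι`
-- is therefore checked on unnormalised fractions.
toℚᵘ-ι : ∀ n → ℚ.toℚᵘ (ι n) ℚᵘ.≃ mkℚᵘ (+ n) 0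
toℚᵘ-ι n = ℚ.toℚᵘ-fromℚᵘ (mkℚᵘ (+ n) 0)

ι-* : ∀ m n → ι (m ℕ.* n) ≡ ι m ℚ.* ι n
ι-* m n = ℚ.toℚᵘ-injective (begin
  ℚ.toℚᵘ (ι (m ℕ.* n))              ≈⟨ toℚᵘ-ι (m ℕ.* n) ⟩
  mkℚᵘ (+ (m ℕ.* n)) 0              ≈⟨ *≡* (cong (ℤ._* + 1) (ℤ.pos-* m n)) ⟩
  mkℚᵘ (+ m) 0 ℚᵘ.* mkℚᵘ (+ n) 0    ≈⟨ ℚᵘ.*-cong (toℚᵘ-ι m) (toℚᵘ-ι n) ⟨
  ℚ.toℚᵘ (ι m) ℚᵘ.* ℚ.toℚᵘ (ι n)    ≈⟨ ℚ.toℚᵘ-homo-* (ι m) (ι n) ⟨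
  ℚ.toℚᵘ (ι m ℚ.* ι n)              ∎)
  where open ℚᵘ.≃-Reasoning

ι-mono-≤ : ∀ {m n} → m ≤ n → ι m ℚ.≤ ι n
ι-mono-≤ {m} {n} m≤n = ℚ.toℚᵘ-cancel-≤ (begin
  ℚ.toℚᵘ (ι m)   ≃⟨ toℚᵘ-ι m ⟩
  mkℚᵘ (+ m) 0   ≤⟨ *≤* (ℤ.*-monoʳ-≤-nonNeg (+ 1) (ℤ.+≤+ m≤n)) ⟩
  mkℚᵘ (+ n) 0   ≃⟨ toℚᵘ-ι n ⟨
  ℚ.toℚᵘ (ι n)   ∎)
  where open ℚᵘ.≤-Reasoning

ι-nonNeg : ∀ n → 0ℚ ℚ.≤ ι n
ι-nonNeg n = ι-mono-≤ {0} {n} z≤n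

ι-^ : ∀ m n → ι (m ℕ.^ n) ≡ ι m ^ n
ι-^ m zero    = refl
ι-^ m (suc n) = trans (ι-* m (m ℕ.^ n)) (cong (ι m ℚ.*_) (ι-^ m n))

ι[1+d]*p : ∀ n d .(c : Coprime ℤ.∣ n ∣ (suc d)) → ι (suc d) ℚ.* mkℚ n d c ≡ n ℚ./ 1
ι[1+d]*p n d c = ℚ.toℚᵘ-injective (begin
  ℚ.toℚᵘ (ι (suc d) ℚ.* mkℚ n d c)     ≈⟨ ℚ.toℚᵘ-homo-* (ι (suc d)) (mkℚ n d c) ⟩
  ℚ.toℚᵘ (ι (suc d)) ℚᵘ.* mkℚᵘ n d     ≈⟨ ℚᵘ.*-congʳ (toℚᵘ-ι (suc d)) ⟩
  mkℚᵘ (+ suc d) 0 ℚᵘ.* mkℚᵘ n d       ≈⟨ *≡* cross ⟩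
  mkℚᵘ n 0                             ≈⟨ ℚ.toℚᵘ-fromℚᵘ (mkℚᵘ n 0) ⟨
  ℚ.toℚᵘ (n ℚ./ 1)                     ∎)
  where
  open ℚᵘ.≃-Reasoning
  cross : + suc d ℤ.* n ℤ.* + 1 ≡ n ℤ.* + suc (d ℕ.+ 0)
  cross rewrite ℕ.+-identityʳ d = trans (ℤ.*-identityʳ (+ suc d ℤ.* n)) (ℤ.*-comm (+ suc d) n)

-- For p = (n+1)/(d+1) the choice k = b (d+1) gives k p = b (n+1) ≥ b. The extra bound `b ≤ k` later
-- pushes the index of a term past any given threshold.
archimedean : ∀ {p} → 0ℚ ℚ.< p → ∀ b → ∃ λ k → b ≤ k × ι b ℚ.≤ ι k ℚ.* p
archimedean {mkℚ n d c} p>0 b with positive {mkℚ n d c} p>0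
-- Positivity leaves only a numerator of the form `+ suc n`.
archimedean {mkℚ (+ suc n) d c} p>0 b | _ = b ℕ.* suc d , ℕ.m≤m*n b (suc d) , (begin
  ι b                                       ≤⟨ ι-mono-≤ (ℕ.m≤m*n b (suc n)) ⟩
  ι (b ℕ.* suc n)                           ≡⟨ ι-* b (suc n) ⟩
  ι b ℚ.* ι (suc n)                         ≡⟨ cong (ι b ℚ.*_) (ι[1+d]*p (+ suc n) d c) ⟨
  ι b ℚ.* (ι (suc d) ℚ.* p)                 ≡⟨ ℚ.*-assoc (ι b) (ι (suc d)) p ⟨
  ι b ℚ.* ι (suc d) ℚ.* p                   ≡⟨ cong (ℚ._* p) (ι-* b (suc d)) ⟨
  ι (b ℕ.* suc d) ℚ.* p                     ∎)
  where open ℚ.≤-Reasoning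
        p = mkℚ (+ suc n) d c

-- Growth of the factorial

-- The last j factors of (j+k)! all exceed k, and the remaining factor k! is at least 1.
k^j≤[j+k]! : ∀ k j → k ℕ.^ j ≤ (j ℕ.+ k) !
k^j≤[j+k]! k zero    = ℕ.1≤n! k
k^j≤[j+k]! k (suc j) = ℕ.*-mono-≤ (ℕ.m≤n+m k (suc j)) (k^j≤[j+k]! k j)

n!²≥n! : ∀ n → n ! ≤ n ! ℕ.* n !
n!²≥n! n = ℕ.m≤m*n (n !) (n !) ⦃ n ℕ.!≢0 ⦄

-- With k p² ≥ b + 1 and n = 2 k one has n! pⁿ ≥ kᵏ p²ᵏ = (k p²)ᵏ ≥ b + 1.
n!*p^n-unbounded : ∀ {p} → 0ℚ ℚ.< p → ∀ b → ∃ λ n → b ≤ n × ι (suc b) ℚ.≤ ι (n !) ℚ.* p ^ n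
n!*p^n-unbounded {p} p>0 b with archimedean (0<p*q p>0 p>0) (suc b)
... | suc k , s≤s b≤k , large = n , ℕ.≤-trans (ℕ.m≤n⇒m≤1+n b≤k) (ℕ.m≤m+n (suc k) (suc k)) , (begin
  ι (suc b)                              ≤⟨ large ⟩
  q                                      ≤⟨ 1≤p⇒p≤p^[1+n] k (ℚ.≤-trans (ι-mono-≤ {1} {suc b} (s≤s z≤n)) large) ⟩
  q ^ suc k                              ≡⟨ ^-distrib-* (ι (suc k)) (p ℚ.* p) (suc k) ⟩
  ι (suc k) ^ suc k ℚ.* (p ℚ.* p) ^ suc k
    ≡⟨ cong₂ ℚ._*_ (sym (ι-^ (suc k) (suc k)))
         (trans (^-distrib-* p p (suc k)) (sym (^-homo-* p (suc k) (suc k)))) ⟩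
  ι (suc k ℕ.^ suc k) ℚ.* p ^ n
    ≤⟨ ℚ.*-monoʳ-≤-nonNeg (p ^ n) ⦃ nonNegative (^-nonNeg n (ℚ.<⇒≤ p>0)) ⦄
         (ι-mono-≤ (k^j≤[j+k]! (suc k) (suc k))) ⟩
  ι (n !) ℚ.* p ^ n                      ∎)
  where open ℚ.≤-Reasoning
        n = suc k ℕ.+ suc k
        q = ι (suc k) ℚ.* (p ℚ.* p)

-- Null sequences

half-pos : ∀ {ε} → 0ℚ ℚ.< ε → 0ℚ ℚ.< ε ℚ.* ½
half-pos ε>0 = 0<p*q ε>0 (ℚ.positive⁻¹ ½)

half+half : ∀ ε → ε ℚ.* ½ ℚ.+ ε ℚ.* ½ ≡ ε
half+half ε = trans (sym (ℚ.*-distribˡ-+ ε ½ ½)) (ℚ.*-identityʳ ε)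

p-0≡p : ∀ p → p ℚ.- 0ℚ ≡ p
p-0≡p = ℚ.+-identityʳ

≈ℝ-respˡ-≗ : ∀ x x′ y → (∀ n → seq x n ≡ seq x′ n) → x ≈ℝ y → x′ ≈ℝ y
≈ℝ-respˡ-≗ x x′ y eq x≈y ε ε>0 with N , close ← x≈y ε ε>0 =
  N , λ n N≤n → subst (λ p → ℚ.∣ p ℚ.- seq y n ∣ ℚ.< ε) (eq n) (close n N≤n)

≈ℝ-refl : ∀ x → x ≈ℝ x
≈ℝ-refl x ε ε>0 =
  0 , λ n _ → subst (ℚ._< ε) (sym (cong ℚ.∣_∣ (ℚ.+-inverseʳ (seq x n)))) ε>0

+-≈0 : ∀ x y t → x ≈ℝ y → t ≈ℝ 0ℝ → x +ℝ t ≈ℝ y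
+-≈0 x y t x≈y t≈0 ε ε>0
  with M , closeˣ ← x≈y (ε ℚ.* ½) (half-pos ε>0)
     | N , closeᵗ ← t≈0 (ε ℚ.* ½) (half-pos ε>0) =
  M ⊔ N , λ n ≤n → begin-strict
    ℚ.∣ (seq x n ℚ.+ seq t n) ℚ.- seq y n ∣
      ≡⟨ cong ℚ.∣_∣ (solve 3 (λ a b c → (a :+ b) :- c := (a :- c) :+ (b :- con 0ℚ)) refl (seq x n) (seq t n) (seq y n)) ⟩
    ℚ.∣ (seq x n ℚ.- seq y n) ℚ.+ (seq t n ℚ.- 0ℚ) ∣
      ≤⟨ ℚ.∣p+q∣≤∣p∣+∣q∣ (seq x n ℚ.- seq y n) (seq t n ℚ.- 0ℚ) ⟩
    ℚ.∣ seq x n ℚ.- seq y n ∣ ℚ.+ ℚ.∣ seq t n ℚ.- 0ℚ ∣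
      <⟨ ℚ.+-mono-< (closeˣ n (ℕ.m⊔n≤o⇒m≤o M N ≤n)) (closeᵗ n (ℕ.m⊔n≤o⇒n≤o M N ≤n)) ⟩
    ε ℚ.* ½ ℚ.+ ε ℚ.* ½
      ≡⟨ half+half ε ⟩
    ε ∎
  where open ℚ.≤-Reasoning
        open +-*-Solver

-‿≈0 : ∀ t → t ≈ℝ 0ℝ → -ℝ t ≈ℝ 0ℝ
-‿≈0 t t≈0 ε ε>0 with N , close ← t≈0 ε ε>0 =
  N , λ n N≤n → subst (ℚ._< ε)
    (trans (sym (ℚ.∣-p∣≡∣p∣ (seq t n ℚ.- 0ℚ))) (cong ℚ.∣_∣ (ℚ.neg-distrib-+ (seq t n) (ℚ.- 0ℚ))))
    (close n N≤n)

-- From some `N` on, a Cauchy sequence stays within 1 of its value at `N`.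
eventually-bounded : ∀ x → ∃ λ b → 0ℚ ℚ.< b × ∃ λ N → ∀ n → N ≤ n → ℚ.∣ seq x n ∣ ℚ.≤ b
eventually-bounded x with N , close ← ℝ.cauchy x 1ℚ (ℚ.positive⁻¹ 1ℚ) =
  1ℚ ℚ.+ ℚ.∣ seq x N ∣
  , ℚ.+-mono-<-≤ (ℚ.positive⁻¹ 1ℚ) (ℚ.0≤∣p∣ (seq x N))
  , N
  , λ n N≤n → begin
      ℚ.∣ seq x n ∣
        ≡⟨ cong ℚ.∣_∣ (solve 2 (λ a b → a := (a :- b) :+ b) refl (seq x n) (seq x N)) ⟩
      ℚ.∣ (seq x n ℚ.- seq x N) ℚ.+ seq x N ∣
        ≤⟨ ℚ.∣p+q∣≤∣p∣+∣q∣ (seq x n ℚ.- seq x N) (seq x N) ⟩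
      ℚ.∣ seq x n ℚ.- seq x N ∣ ℚ.+ ℚ.∣ seq x N ∣
        ≤⟨ ℚ.+-monoˡ-≤ ℚ.∣ seq x N ∣ (ℚ.<⇒≤ (close n N N≤n ℕ.≤-refl)) ⟩
      1ℚ ℚ.+ ℚ.∣ seq x N ∣ ∎
  where open ℚ.≤-Reasoning
        open +-*-Solver

quotient : ∀ {p q} → 0ℚ ℚ.< p → 0ℚ ℚ.< q → ∃ λ r → 0ℚ ℚ.< r × r ℚ.* q ≡ p
quotient {p} {q} p>0 q>0 = p ℚ.* ℚ.1/ q
  , 0<p*q p>0 (ℚ.positive⁻¹ (ℚ.1/ q) ⦃ ℚ.1/pos⇒pos q ⦄)
  , trans (ℚ.*-assoc p (ℚ.1/ q) q) (trans (cong (p ℚ.*_) (ℚ.*-inverseˡ q)) (ℚ.*-identityʳ p))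
  where instance
    _ = positive q>0
    _ = ℚ.pos⇒nonZero q

-- With b an eventual bound for `x`, it suffices to bring `t` within δ = ε / b of zero.
*-≈0ˡ : ∀ t x → t ≈ℝ 0ℝ → t *ℝ x ≈ℝ 0ℝ
*-≈0ˡ t x t≈0 ε ε>0 =
  let b , b>0 , M , x≤b = eventually-bounded x
      δ , δ>0 , δb≡ε    = quotient ε>0 b>0
      N , close         = t≈0 δ δ>0
  in M ⊔ N , λ n ≤n → product-small (seq t n) (seq x n) b>0 δb≡ε
       (close n (ℕ.m⊔n≤o⇒n≤o M N ≤n)) (x≤b n (ℕ.m⊔n≤o⇒m≤o M N ≤n))
  where
  open ℚ.≤-Reasoning
  product-small : ∀ p q {b δ} → 0ℚ ℚ.< b → δ ℚ.* b ≡ ε →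
    ℚ.∣ p ℚ.- 0ℚ ∣ ℚ.< δ → ℚ.∣ q ∣ ℚ.≤ b → ℚ.∣ p ℚ.* q ℚ.- 0ℚ ∣ ℚ.< ε
  product-small p q {b} {δ} b>0 δb≡ε p<δ q≤b = begin-strict
    ℚ.∣ p ℚ.* q ℚ.- 0ℚ ∣     ≡⟨ cong ℚ.∣_∣ (p-0≡p (p ℚ.* q)) ⟩
    ℚ.∣ p ℚ.* q ∣            ≡⟨ ℚ.∣p*q∣≡∣p∣*∣q∣ p q ⟩
    ℚ.∣ p ∣ ℚ.* ℚ.∣ q ∣       ≤⟨ ℚ.*-monoˡ-≤-nonNeg ℚ.∣ p ∣ ⦃ ℚ.∣-∣-nonNeg p ⦄ q≤b ⟩
    ℚ.∣ p ∣ ℚ.* b            ≡⟨ cong (λ r → ℚ.∣ r ∣ ℚ.* b) (p-0≡p p) ⟨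
    ℚ.∣ p ℚ.- 0ℚ ∣ ℚ.* b     <⟨ ℚ.*-monoˡ-<-pos b ⦃ positive b>0 ⦄ p<δ ⟩
    δ ℚ.* b                 ≡⟨ δb≡ε ⟩
    ε                       ∎

*-≈0ʳ : ∀ x t → t ≈ℝ 0ℝ → x *ℝ t ≈ℝ 0ℝ
*-≈0ʳ x t t≈0 = ≈ℝ-respˡ-≗ (t *ℝ x) (x *ℝ t) 0ℝ (λ n → ℚ.*-comm (seq t n) (seq x n)) (*-≈0ˡ t x t≈0)

-- Complex null sequences

≈ᶜ-refl : ∀ z → z ≈ᶜ z
≈ᶜ-refl z = ≈ℝ-refl (re z) , ≈ℝ-refl (im z)

+ᶜ-≈0 : ∀ z w t → z ≈ᶜ w → t ≈ᶜ 0ᶜ → z +ᶜ t ≈ᶜ w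
+ᶜ-≈0 z w t (re≈ , im≈) (re≈0 , im≈0) =
  +-≈0 (re z) (re w) (re t) re≈ re≈0 , +-≈0 (im z) (im w) (im t) im≈ im≈0

*ᶜ-≈0ˡ : ∀ t w → t ≈ᶜ 0ᶜ → t *ᶜ w ≈ᶜ 0ᶜ
*ᶜ-≈0ˡ t w (re≈0 , im≈0) =
  +-≈0 (re t *ℝ re w) 0ℝ (-ℝ (im t *ℝ im w))
    (*-≈0ˡ (re t) (re w) re≈0) (-‿≈0 (im t *ℝ im w) (*-≈0ˡ (im t) (im w) im≈0)) ,
  +-≈0 (re t *ℝ im w) 0ℝ (im t *ℝ re w)
    (*-≈0ˡ (re t) (im w) re≈0) (*-≈0ˡ (im t) (re w) im≈0)

*ᶜ-≈0ʳ : ∀ w t → t ≈ᶜ 0ᶜ → w *ᶜ t ≈ᶜ 0ᶜ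
*ᶜ-≈0ʳ w t (re≈0 , im≈0) =
  +-≈0 (re w *ℝ re t) 0ℝ (-ℝ (im w *ℝ im t))
    (*-≈0ʳ (re w) (re t) re≈0) (-‿≈0 (im w *ℝ im t) (*-≈0ʳ (im w) (im t) im≈0)) ,
  +-≈0 (re w *ℝ im t) 0ℝ (im w *ℝ re t)
    (*-≈0ʳ (re w) (im t) im≈0) (*-≈0ʳ (im w) (re t) re≈0)

*ᶜ-identityʳ : ∀ z → z *ᶜ 1ᶜ ≈ᶜ z
*ᶜ-identityʳ z =
  ≈ℝ-respˡ-≗ (re z) (re (z *ᶜ 1ᶜ)) (re z)
    (λ n → solve 2 (λ a b → a := a :* con 1ℚ :- b :* con 0ℚ) refl (seq (re z) n) (seq (im z) n))
    (≈ℝ-refl (re z)) ,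
  ≈ℝ-respˡ-≗ (im z) (im (z *ᶜ 1ᶜ)) (im z)
    (λ n → solve 2 (λ a b → b := a :* con 0ℚ :+ b :* con 1ℚ) refl (seq (re z) n) (seq (im z) n))
    (≈ℝ-refl (im z))
  where open +-*-Solver

-- Turns equality of complex numbers into the closeness condition in the definition of `_⟶_`.
≈ᶜ⇒∣-∣²< : ∀ z w → z ≈ᶜ w → ∀ ε → 0ℝ <ℝ ε → ∣ z -ᶜ w ∣² <ℝ ε *ℝ ε
≈ᶜ⇒∣-∣²< z w (re≈ , im≈) ε (δ , δ>0 , K , δ≤ε)
  -- With both coordinates within δ/2 the squared distance is at most δ²/2. The other half of δ² ≤
  -- ε² is the rational gap η that `_<ℝ_` asks for.
  with M , closeʳ ← re≈ (δ ℚ.* ½) (half-pos δ>0)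
     | N , closeⁱ ← im≈ (δ ℚ.* ½) (half-pos δ>0) =
  η , half-pos (0<p*q δ>0 δ>0) , K ⊔ (M ⊔ N) , λ n ≤n →
  let MN≤n = ℕ.m⊔n≤o⇒n≤o K (M ⊔ N) ≤n
      δ≤εₙ = subst (ℚ._≤ seq ε n) (ℚ.+-identityˡ δ) (δ≤ε n (ℕ.m⊔n≤o⇒m≤o K (M ⊔ N) ≤n))
      a    = seq (re z) n ℚ.- seq (re w) n
      b    = seq (im z) n ℚ.- seq (im w) n
  in begin
    a ℚ.* a ℚ.+ b ℚ.* b ℚ.+ η
      ≤⟨ ℚ.+-monoˡ-≤ η (ℚ.+-mono-≤
           (∣p∣≤q⇒p²≤q² a (ℚ.<⇒≤ (closeʳ n (ℕ.m⊔n≤o⇒m≤o M N MN≤n))))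
           (∣p∣≤q⇒p²≤q² b (ℚ.<⇒≤ (closeⁱ n (ℕ.m⊔n≤o⇒n≤o M N MN≤n))))) ⟩
    δ ℚ.* ½ ℚ.* (δ ℚ.* ½) ℚ.+ δ ℚ.* ½ ℚ.* (δ ℚ.* ½) ℚ.+ η
      ≡⟨ solve 1 (λ d → d :* con ½ :* (d :* con ½) :+ d :* con ½ :* (d :* con ½) :+ d :* d :* con ½
                        := d :* d) refl δ ⟩
    δ ℚ.* δ
      ≤⟨ *-mono-≤ (ℚ.<⇒≤ δ>0) (ℚ.≤-trans (ℚ.<⇒≤ δ>0) δ≤εₙ) δ≤εₙ δ≤εₙ ⟩
    seq ε n ℚ.* seq ε n ∎
  where open ℚ.≤-Reasoning
        open +-*-Solver
        η = δ ℚ.* δ ℚ.* ½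

-- Power series

-- Serves both convergent cases: vanishing coefficients and z ≈ 0.
partialSum≈a₀ : ∀ a z → (∀ n → a (suc n) *ᶜ z ^ᶜ suc n ≈ᶜ 0ᶜ) → ∀ N → partialSum a z N ≈ᶜ a 0
-- The power `z ^ᶜ 0` is 1 for every z, including zero, so the constant term survives.
partialSum≈a₀ a z terms≈0 zero    = *ᶜ-identityʳ (a 0)
partialSum≈a₀ a z terms≈0 (suc N) =
  +ᶜ-≈0 (partialSum a z N) (a 0) (a (suc N) *ᶜ z ^ᶜ suc N) (partialSum≈a₀ a z terms≈0 N) (terms≈0 N)

sumsTo-a₀ : ∀ a z → (∀ n → a (suc n) *ᶜ z ^ᶜ suc n ≈ᶜ 0ᶜ) → SumsTo a z (a 0)
sumsTo-a₀ a z terms≈0 ε ε>0 =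
  0 , λ n _ → ≈ᶜ⇒∣-∣²< (partialSum a z n) (a 0) (partialSum≈a₀ a z terms≈0 n) ε ε>0

sumsTo-a₀-at-0 : ∀ a z → z ≈ᶜ 0ᶜ → SumsTo a z (a 0)
sumsTo-a₀-at-0 a z z≈0 =
  sumsTo-a₀ a z λ n → *ᶜ-≈0ʳ (a (suc n)) (z ^ᶜ suc n) (*ᶜ-≈0ˡ z (z ^ᶜ n) z≈0)

-- Squared moduli of the terms

-- The Brahmagupta-Fibonacci identity, exact at every rational approximation k.
∣*∣² : ∀ z w k → seq ∣ z *ᶜ w ∣² k ≡ seq ∣ z ∣² k ℚ.* seq ∣ w ∣² k
∣*∣² z w k = solve 4
  (λ a b c d → (a :* c :- b :* d) :* (a :* c :- b :* d) :+ (a :* d :+ b :* c) :* (a :* d :+ b :* c)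
               := (a :* a :+ b :* b) :* (c :* c :+ d :* d))
  refl (seq (re z) k) (seq (im z) k) (seq (re w) k) (seq (im w) k)
  where open +-*-Solver

∣^∣² : ∀ z n k → seq ∣ z ^ᶜ n ∣² k ≡ seq ∣ z ∣² k ^ n
∣^∣² z zero    k = refl
∣^∣² z (suc n) k = trans (∣*∣² z (z ^ᶜ n) k) (cong (seq ∣ z ∣² k ℚ.*_) (∣^∣² z n k))

∣fromℕᶜ∣² : ∀ m k → seq ∣ fromℕᶜ m ∣² k ≡ ι (m ℕ.* m)
∣fromℕᶜ∣² m k = trans (ℚ.+-identityʳ (ι m ℚ.* ι m)) (sym (ι-* m m))

-- The two sides differ by (p+q)².
2[p²+q²]≥[p-q]² : ∀ p q → (p ℚ.- q) ℚ.* (p ℚ.- q) ℚ.≤ (p ℚ.* p ℚ.+ q ℚ.* q) ℚ.+ (p ℚ.* p ℚ.+ q ℚ.* q)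
2[p²+q²]≥[p-q]² p q = begin
  (p ℚ.- q) ℚ.* (p ℚ.- q)
    ≡⟨ ℚ.+-identityʳ _ ⟨
  (p ℚ.- q) ℚ.* (p ℚ.- q) ℚ.+ 0ℚ
    ≤⟨ ℚ.+-monoʳ-≤ ((p ℚ.- q) ℚ.* (p ℚ.- q)) (0≤p² (p ℚ.+ q)) ⟩
  (p ℚ.- q) ℚ.* (p ℚ.- q) ℚ.+ (p ℚ.+ q) ℚ.* (p ℚ.+ q)
    ≡⟨ solve 2 (λ a b → (a :- b) :* (a :- b) :+ (a :+ b) :* (a :+ b)
                        := (a :* a :+ b :* b) :+ (a :* a :+ b :* b)) refl p q ⟩
  (p ℚ.* p ℚ.+ q ℚ.* q) ℚ.+ (p ℚ.* p ℚ.+ q ℚ.* q) ∎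
  where open ℚ.≤-Reasoning
        open +-*-Solver

-- The term is t = (u+t-s) - (u-s), and ∣v-w∣² ≤ 2 (∣v∣² + ∣w∣²) ≤ 4 when both squared moduli are at
-- most 1.
∣t∣²≤4 : ∀ u t s k → seq ∣ (u +ᶜ t) -ᶜ s ∣² k ℚ.≤ 1ℚ → seq ∣ u -ᶜ s ∣² k ℚ.≤ 1ℚ →
         seq ∣ t ∣² k ℚ.≤ ι 4
∣t∣²≤4 u t s k near₁ near₀ = begin
  seq ∣ t ∣² k
    ≡⟨ cong₂ ℚ._+_ (cong₂ ℚ._*_ (t≡p-q a c e) (t≡p-q a c e)) (cong₂ ℚ._*_ (t≡p-q b d f) (t≡p-q b d f)) ⟩
  (p ℚ.- q) ℚ.* (p ℚ.- q) ℚ.+ (p′ ℚ.- q′) ℚ.* (p′ ℚ.- q′)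
    ≤⟨ ℚ.+-mono-≤ (2[p²+q²]≥[p-q]² p q) (2[p²+q²]≥[p-q]² p′ q′) ⟩
  ((p ℚ.* p ℚ.+ q ℚ.* q) ℚ.+ (p ℚ.* p ℚ.+ q ℚ.* q)) ℚ.+ ((p′ ℚ.* p′ ℚ.+ q′ ℚ.* q′) ℚ.+ (p′ ℚ.* p′ ℚ.+ q′ ℚ.* q′))
    ≡⟨ solve 4 (λ A B C D → ((A :+ B) :+ (A :+ B)) :+ ((C :+ D) :+ (C :+ D))
                            := ((A :+ C) :+ (B :+ D)) :+ ((A :+ C) :+ (B :+ D)))
         refl (p ℚ.* p) (q ℚ.* q) (p′ ℚ.* p′) (q′ ℚ.* q′) ⟩
  (P ℚ.+ Q) ℚ.+ (P ℚ.+ Q)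
    ≤⟨ ℚ.+-mono-≤ (ℚ.+-mono-≤ near₁ near₀) (ℚ.+-mono-≤ near₁ near₀) ⟩
  ι 4 ∎
  where
  open ℚ.≤-Reasoning
  open +-*-Solver
  a = seq (re u) k
  b = seq (im u) k
  c = seq (re t) k
  d = seq (im t) k
  e = seq (re s) k
  f = seq (im s) k
  -- `p` and `p′` are the coordinates of u+t-s, `q` and `q′` those of u-s; `P` and `Q` are the
  -- squared moduli.
  p = a ℚ.+ c ℚ.- e
  q = a ℚ.- e
  p′ = b ℚ.+ d ℚ.- f
  q′ = b ℚ.- f
  P = p ℚ.* p ℚ.+ p′ ℚ.* p′
  Q = q ℚ.* q ℚ.+ q′ ℚ.* q′
  t≡p-q : ∀ x y w → y ≡ (x ℚ.+ y ℚ.- w) ℚ.- (x ℚ.- w)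
  t≡p-q = solve 3 (λ x y w → y := (x :+ y :- w) :- (x :- w)) refl

<1⇒eventually≤1 : ∀ {x} → x <ℝ fromℚ 1ℚ *ℝ fromℚ 1ℚ → ∃ λ K → ∀ k → K ≤ k → seq x k ℚ.≤ 1ℚ
<1⇒eventually≤1 {x} (δ , δ>0 , K , x+δ≤1) = K , λ k K≤k → begin
  seq x k           ≡⟨ ℚ.+-identityʳ (seq x k) ⟨
  seq x k ℚ.+ 0ℚ    ≤⟨ ℚ.+-monoʳ-≤ (seq x k) (ℚ.<⇒≤ δ>0) ⟩
  seq x k ℚ.+ δ     ≤⟨ x+δ≤1 k K≤k ⟩
  1ℚ                ∎
  where open ℚ.≤-Reasoning

0<1 : 0ℝ <ℝ fromℚ 1ℚ
0<1 = 1ℚ , ℚ.positive⁻¹ 1ℚ , 0 , λ _ _ → ℚ.≤-refl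

-- Taking ε = 1 in the limit, term n is the difference of partial sums n and n-1, both within 1 of
-- the sum. The strict `N < n` keeps n-1 at or beyond `N`; the precision `K` may depend on n.
converges⇒terms-bounded : ∀ a z → ConvergesAt a z → ∃ λ N → ∀ n → N ℕ.< n →
  ∃ λ K → ∀ k → K ≤ k → seq ∣ a n *ᶜ z ^ᶜ n ∣² k ℚ.≤ ι 4
converges⇒terms-bounded a z (s , S⟶s) with N , near ← S⟶s (fromℚ 1ℚ) 0<1 = N , bound
  where
  bound : ∀ n → N ℕ.< n → ∃ λ K → ∀ k → K ≤ k → seq ∣ a n *ᶜ z ^ᶜ n ∣² k ℚ.≤ ι 4
  bound (suc n) (s≤s N≤n)
    with K , near₀ ← <1⇒eventually≤1 {∣ partialSum a z n -ᶜ s ∣²} (near n N≤n)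
       | L , near₁ ← <1⇒eventually≤1 {∣ partialSum a z (suc n) -ᶜ s ∣²} (near (suc n) (ℕ.m≤n⇒m≤1+n N≤n)) =
    K ⊔ L , λ k ≤k → ∣t∣²≤4 (partialSum a z n) (a (suc n) *ᶜ z ^ᶜ suc n) s k
      (near₁ k (ℕ.m⊔n≤o⇒n≤o K L ≤k)) (near₀ k (ℕ.m⊔n≤o⇒m≤o K L ≤k))

-- The squared modulus is (n!)² (∣z∣²)ⁿ. One factor n! is given up and ∣z∣² is replaced by its lower
-- bound p, which reaches the form of the growth estimate.
∣n!*z^n∣²≥n!*p^n : ∀ z n k {p} → 0ℚ ℚ.≤ p → p ℚ.≤ seq ∣ z ∣² k →
  ι (n !) ℚ.* p ^ n ℚ.≤ seq ∣ fromℕᶜ (n !) *ᶜ z ^ᶜ n ∣² k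
∣n!*z^n∣²≥n!*p^n z n k {p} p≥0 p≤∣z∣² = subst (ι (n !) ℚ.* p ^ n ℚ.≤_)
  (sym (trans (∣*∣² (fromℕᶜ (n !)) (z ^ᶜ n) k) (cong₂ ℚ._*_ (∣fromℕᶜ∣² (n !) k) (∣^∣² z n k))))
  (*-mono-≤ (ι-nonNeg (n !)) (^-nonNeg n (ℚ.≤-trans p≥0 p≤∣z∣²))
     (ι-mono-≤ (n!²≥n! n)) (^-mono-≤ n p≥0 p≤∣z∣²))

-- One index n, fixed before k, suffices: an approximation of ∣z∣² that is at least ε would give 4 <
-- b + 1 ≤ n! εⁿ ≤ ∣aₙ zⁿ∣² ≤ 4. The order on rationals is decidable, so refuting this yields the
-- strict bound.
∣z∣²-small : ∀ a z n₀ → (∀ n → n₀ ≤ n → a n ≡ fromℕᶜ (n !)) → ConvergesAt a z →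
  ∀ ε → 0ℚ ℚ.< ε → ∃ λ K → ∀ k → K ≤ k → seq ∣ z ∣² k ℚ.< ε
∣z∣²-small a z n₀ a≡! conv ε ε>0 =
  let N , bounded     = converges⇒terms-bounded a z conv
      n , b≤n , large = n!*p^n-unbounded ε>0 (b N)
      -- `b N` unfolds to `suc (3 + (n₀ ⊔ N))`, which supplies the strict `N < n`.
      K , ∣aₙzⁿ∣²≤4   = bounded n (ℕ.≤-trans (s≤s (ℕ.≤-trans (ℕ.m≤n⊔m n₀ N) (ℕ.m≤n+m (n₀ ⊔ N) 3))) b≤n)
      n₀≤n            = ℕ.≤-trans (ℕ.≤-trans (ℕ.m≤m⊔n n₀ N) (ℕ.m≤n+m (n₀ ⊔ N) 4)) b≤n
  in K , λ k K≤k → ℚ.≰⇒> λ ε≤∣z∣² → ℚ.<-irrefl refl (ℚ.<-≤-trans (4<b N)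
       (ℚ.≤-trans large (ℚ.≤-trans (∣n!*z^n∣²≥n!*p^n z n k (ℚ.<⇒≤ ε>0) ε≤∣z∣²)
         (subst (λ w → seq ∣ w *ᶜ z ^ᶜ n ∣² k ℚ.≤ ι 4) (a≡! n n₀≤n) (∣aₙzⁿ∣²≤4 k K≤k)))))
  where
  b : ℕ → ℕ
  -- One threshold does three jobs: it makes `suc (b N)` exceed 4, forces n past `n₀`, and forces n
  -- past `N`.
  b N = 4 ℕ.+ (n₀ ⊔ N)
  4<b : ∀ N → ι 4 ℚ.< ι (suc (b N))
  4<b N = ℚ.<-≤-trans (ℚ.*<* (ℤ.+<+ (ℕ.≤-refl {5}))) (ι-mono-≤ {5} (ℕ.m≤m+n 5 (n₀ ⊔ N)))

-- The bound ∣z∣² < ε² holds for each coordinate squared, since the other square is nonnegative;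
-- hence each coordinate is below ε in absolute value.
factorial-converges⇒≈0 : ∀ a z n₀ → (∀ n → n₀ ≤ n → a n ≡ fromℕᶜ (n !)) →
  ConvergesAt a z → z ≈ᶜ 0ᶜ
factorial-converges⇒≈0 a z n₀ a≡! conv =
  (λ ε ε>0 → let K , small = ∣z∣²-small a z n₀ a≡! conv (ε ℚ.* ε) (0<p*q ε>0 ε>0) in
    K , λ k K≤k → close (seq (re z) k) ε>0
      (ℚ.≤-<-trans (p≤p+q (0≤p² (seq (im z) k))) (small k K≤k))) ,
  (λ ε ε>0 → let K , small = ∣z∣²-small a z n₀ a≡! conv (ε ℚ.* ε) (0<p*q ε>0 ε>0) in
    K , λ k K≤k → close (seq (im z) k) ε>0
      (ℚ.≤-<-trans (p≤q+p (0≤p² (seq (re z) k))) (small k K≤k)))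
  where
  close : ∀ p {ε} → 0ℚ ℚ.< ε → p ℚ.* p ℚ.< ε ℚ.* ε → ℚ.∣ p ℚ.- 0ℚ ∣ ℚ.< ε
  close p {ε} ε>0 p²<ε² =
    subst (λ q → ℚ.∣ q ∣ ℚ.< ε) (sym (p-0≡p p)) (p²<q²⇒∣p∣<q p (ℚ.<⇒≤ ε>0) p²<ε²)
  p≤p+q : ∀ {p q} → 0ℚ ℚ.≤ q → p ℚ.≤ p ℚ.+ q
  p≤p+q {p} {q} q≥0 = subst (ℚ._≤ p ℚ.+ q) (ℚ.+-identityʳ p) (ℚ.+-monoʳ-≤ p q≥0)
  p≤q+p : ∀ {p q} → 0ℚ ℚ.≤ q → p ℚ.≤ q ℚ.+ p
  p≤q+p {p} {q} q≥0 = subst (ℚ._≤ q ℚ.+ p) (ℚ.+-identityˡ p) (ℚ.+-monoˡ-≤ p q≥0)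

-- Coefficients and halting

coeff-halted : ∀ P x n → HaltedBy P x n → coeff P x n ≡ fromℕᶜ (n !)
coeff-halted P x n h rewrite dec-true (haltedBy? P x n) h = refl

coeff-running : ∀ P x n → ¬ HaltedBy P x n → coeff P x n ≡ 0ᶜ
coeff-running P x n ¬h rewrite dec-false (haltedBy? P x n) ¬h = refl

haltedBy-mono : ∀ P x {m n} → m ≤ n → HaltedBy P x m → HaltedBy P x n
haltedBy-mono P x m≤n (i , i≤m , h) = i , ℕ.≤-trans i≤m m≤n , h

theorem3 : (P : Program) (x : Input) →
    (¬ Halts P x → (z : ℂ) → SumsTo (coeff P x) z 0ᶜ) ×
    (Halts P x → (z : ℂ) →
    (ConvergesAt (coeff P x) z ⇔ z ≈ᶜ 0ᶜ) ×
    (¬ (z ≈ᶜ 0ᶜ) → DivergesAt (coeff P x) z))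
theorem3 P x = nonHalting , halting
  where
  a = coeff P x
  nonHalting : ¬ Halts P x → (z : ℂ) → SumsTo a z 0ᶜ
  -- The series sums to its constant coefficient, which here equals `0ᶜ`.
  nonHalting ¬halts z = subst (SumsTo a z) (a≡0 0) (sumsTo-a₀ a z λ n →
    *ᶜ-≈0ˡ (a (suc n)) (z ^ᶜ suc n) (subst (_≈ᶜ 0ᶜ) (sym (a≡0 (suc n))) (≈ᶜ-refl 0ᶜ)))
    where
    a≡0 : ∀ n → a n ≡ 0ᶜ
    a≡0 n = coeff-running P x n λ h → ¬halts (n , h)
  halting : Halts P x → (z : ℂ) →
    (ConvergesAt a z ⇔ z ≈ᶜ 0ᶜ) × (¬ (z ≈ᶜ 0ᶜ) → DivergesAt a z)
  -- At z ≈ 0 the sum is `a 0`; divergence elsewhere is the contrapositive of `to`.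
  halting (n₀ , h) z = mk⇔ to (λ z≈0 → a 0 , sumsTo-a₀-at-0 a z z≈0) , λ z≉0 → z≉0 ∘ to
    where
    to : ConvergesAt a z → z ≈ᶜ 0ᶜ
    to = factorial-converges⇒≈0 a z n₀ λ n n₀≤n → coeff-halted P x n (haltedBy-mono P x n₀≤n h)
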